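{- For any integers $n$ and $k$ with $0\le k\le n-1$, there exists a weak cycle $D$ on $n$ vertices such that $F(D)=k$.
   Context: A finite simple digraph $D=(V,A)$ has finite nonempty vertex set $V$ and arc set $A$ consisting of ordered pairs of distinct vertices (no loops, no parallel arcs; both $(u,v)$ and $(v,u)$ may be present). $N_D^+(v)=\{u:(v,u)\in A\}$. A weak cycle is a digraph whose underlying simple undirected graph (replace each arc $(u,v)$ by the edge $\{u,v\}$) is a cycle; by convention the single vertex $K_1$ and any digraph whose underlying graph is $K_2$ are also included as weak cycles. Zero forcing: for $S\subseteq V$ let $B^0(S)=S$ and $B^{i+1}(S)=B^i(S)\cup\{w:\{w\}=N_D^+(v)\setminus B^i(S)\text{ for some }v\in B^i(S)\}$. $S$ is a zero forcing set (ZFS) if $B^t(S)=V$ for some $t\ge 0$, and a failed zero forcing set (FZFS) otherwise. The failed zero forcing number $F(D)$ is the largest cardinality of an FZFS of $D$. -}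

module Defs where

open import Level using (0ℓ)
open import Data.Nat.Base as ℕ using (ℕ; zero; suc; _≤_)
open import Data.Nat.Properties using (1+n≢n)
open import Data.Fin.Base using (Fin; toℕ)
open import Data.Fin.Properties using (any?)
open import Data.Fin.Subset using (Subset; ⊤; ∣_∣; _∈_; _∪_; _─_; ⁅_⁆)
open import Data.Fin.Subset.Properties using (_∈?_)
open import Data.Bool.Properties using () renaming (_≟_ to _≟ᵇ_)
open import Data.Vec.Base using (tabulate)
open import Data.Vec.Properties using (≡-dec)
open import Data.Product.Base using (_×_; _,_; ∃-syntax; Σ-syntax)
open import Data.Sum.Base using (_⊎_; inj₁; inj₂; [_,_]; swap)
open import Function.Bundles using (_↔_; _⇔_; module Inverse)
open import Relation.Nullary using (¬_; does; _×-dec_)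
open import Relation.Unary using (Pred) renaming (Decidable to Decidable₁)
open import Relation.Binary.Core using (Rel)
open import Relation.Binary.Definitions using (Decidable; DecidableEquality; Symmetric)
open import Relation.Binary.PropositionalEquality
  using (_≡_; _≢_; refl; sym; ≢-sym)

-- A finite simple digraph on n labelled vertices. Decidability of the arc
-- relation is what makes the arcs a (finite) subset of Fin n × Fin n.
-- The vertex set is allowed to be empty here; IsWeakCycle below excludes n = 0.
record Digraph (n : ℕ) : Set₁ where
  field
    Arc      : Rel (Fin n) 0ℓ
    arc?     : Decidable Arc
    loopless : ∀ v → ¬ Arc v v

record Graph (n : ℕ) : Set₁ where
  field
    Edge     : Rel (Fin n) 0ℓ
    symm     : Symmetric Edge
    loopless : ∀ v → ¬ Edge v v

infix 4 _≅_
_≅_ : ∀ {m n} → Graph m → Graph n → Set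
_≅_ {m} {n} G H =
  Σ[ f ∈ Fin m ↔ Fin n ]
    (∀ u v → Graph.Edge G u v ⇔ Graph.Edge H (Inverse.to f u) (Inverse.to f v))

underlying : ∀ {n} → Digraph n → Graph n
underlying D = record
  { Edge     = λ u v → Arc u v ⊎ Arc v u
  ; symm     = swap
  ; loopless = λ v → [ loopless v , loopless v ]
  }
  where open Digraph D

completeGraph : ∀ n → Graph n
completeGraph n = record
  { Edge     = _≢_
  ; symm     = ≢-sym
  ; loopless = λ v v≢v → v≢v refl
  }

-- j is the cyclic successor of i among 0, 1, …, n - 1.
Next : ∀ {n} → Rel (Fin n) 0ℓ
Next {n} i j = toℕ j ≡ suc (toℕ i) ⊎ (suc (toℕ i) ≡ n × toℕ j ≡ 0)

-- The cycle with edges {i , i + 1 mod n}; the bound n ≥ 3 is needed for it to be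
-- a cycle in a simple graph.
cycleGraph : ∀ n → 3 ≤ n → Graph n
cycleGraph n 3≤n = record
  { Edge     = λ i j → Next i j ⊎ Next j i
  ; symm     = swap
  ; loopless = λ v → [ irrefl 3≤n v , irrefl 3≤n v ]
  }
  where
  irrefl : ∀ {n} → 3 ≤ n → ∀ (v : Fin n) → ¬ Next v v
  irrefl _ v (inj₁ v≡1+v)         = 1+n≢n (sym v≡1+v)
  irrefl (ℕ.s≤s (ℕ.s≤s _)) v (inj₂ (1+v≡n , v≡0)) with toℕ v
  irrefl (ℕ.s≤s (ℕ.s≤s _)) v (inj₂ (() , refl)) | .0

IsWeakCycle : ∀ {n} → Digraph n → Set
IsWeakCycle D =
    underlying D ≅ completeGraph 1
  ⊎ underlying D ≅ completeGraph 2
  ⊎ (∃[ m ] Σ[ 3≤m ∈ 3 ≤ m ] underlying D ≅ cycleGraph m 3≤m)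

subset : ∀ {n} {P : Pred (Fin n) 0ℓ} → Decidable₁ P → Subset n
subset P? = tabulate (λ v → does (P? v))

_≟ˢ_ : ∀ {n} → DecidableEquality (Subset n)
_≟ˢ_ = ≡-dec _≟ᵇ_

module _ {n : ℕ} (D : Digraph n) where
  open Digraph D

  N⁺ : Fin n → Subset n
  N⁺ v = subset (arc? v)

  Forced : Subset n → Pred (Fin n) 0ℓ
  Forced B w = ∃[ v ] (v ∈ B × N⁺ v ─ B ≡ ⁅ w ⁆)

  forced? : ∀ B → Decidable₁ (Forced B)
  forced? B w = any? (λ v → (v ∈? B) ×-dec ((N⁺ v ─ B) ≟ˢ ⁅ w ⁆))

  B^ : ℕ → Subset n → Subset n
  B^ zero    S = S
  B^ (suc i) S = B^ i S ∪ subset (forced? (B^ i S))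

  IsZFS : Subset n → Set
  IsZFS S = ∃[ t ] B^ t S ≡ ⊤

  IsFZFS : Subset n → Set
  IsFZFS S = ¬ IsZFS S

  -- F(D) = k, with F(D) given by its defining property: k is the maximum of the
  -- cardinalities of failed zero forcing sets.
  FailedZeroForcingNumber : ℕ → Set
  FailedZeroForcingNumber k =
    (∃[ S ] (IsFZFS S × ∣ S ∣ ≡ k)) × (∀ S → IsFZFS S → ∣ S ∣ ≤ k)

{-# OPTIONS --safe #-}
-- A set fails to force exactly when its closure under forcing is proper, so F(D) is
-- the largest size of a proper set closed under forcing.  All digraphs used lie on
-- the directed cycle 0 → 1 → … → n - 1 → 0 (possibly without the arc 0 → 1), with some
-- backward arcs i → i - 1 added.
--
-- * 2k < n: the full directed cycle, with backward arcs out of O = {1, 3, …, 2k - 1}.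
--   A vertex outside O forces its successor, and two consecutive vertices force the
--   next one, so a closed set not contained in O is everything; O itself is closed.
-- * 2k ≥ n, w = n - k: omit 0 → 1 and put backward arcs out of 1, …, 2w - 1.  A closed
--   set containing both 2i and 2i + 1 for some i < w spreads forwards around to 0 and
--   then backwards from 2i, so a proper one misses at least w vertices; the complement
--   of {1, 3, …, 2w - 1} is closed.
module Submission where

open import Defs
open import Level using (0ℓ)
open import Data.Nat using (ℕ; zero; suc; _+_; _*_; _∸_; _≤_; _<_; z≤n; s≤s; z<s; s<s; s≤s⁻¹;
  parity; _<?_; _≤?_)
open import Data.Nat.Properties as ℕ using ()
open import Data.Parity.Base using (1ℙ)
open import Data.Parity.Properties using () renaming (_≟_ to _≟ᵖ_)
open import Data.Bool.Base using (true)
open import Data.Fin.Base using (Fin; zero; suc; toℕ; fromℕ; fromℕ<; inject₁)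
open import Data.Fin.Properties
  using (any?; _≟_; toℕ<n; toℕ-injective; toℕ-inject₁; toℕ-fromℕ; toℕ-fromℕ<; ≤fromℕ)
open import Data.Fin.Induction using (<-weakInduction-startingFrom; >-weakInduction)
open import Data.Fin.Subset using (Subset; inside; outside; ⊤; ∁; ∣_∣; _∈_; _∉_; _⊆_; _─_; ⁅_⁆)
open import Data.Fin.Subset.Properties
open import Data.Vec.Base using ([]; _∷_; here; there)
open import Data.Vec.Properties using (lookup∘tabulate; []=⇒lookup; lookup⇒[]=)
open import Data.Product using (Σ-syntax; ∃-syntax; _×_; _,_; proj₁; proj₂)
open import Data.Sum using (_⊎_; inj₁; inj₂; [_,_]′; swap)
open import Data.Unit.Base using (tt) renaming (⊤ to Unit)
open import Data.Empty using (⊥; ⊥-elim)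
open import Function.Base using (_∘_; id)
open import Function.Bundles using (_⇔_; mk⇔)
open import Function.Construct.Composition using (_⇔-∘_)
open import Function.Construct.Identity using (↔-id)
open import Relation.Nullary using (¬_; Dec; does; yes; no; contradiction; ¬?; _×-dec_; _⊎-dec_)
open import Relation.Nullary.Decidable using (dec-true; decidable-stable)
open import Relation.Unary using (Pred) renaming (Decidable to Decidable₁)
open import Relation.Binary.Definitions using (Decidable)
open import Relation.Binary.PropositionalEquality
  using (_≡_; _≢_; refl; sym; trans; cong; subst)

-- Membership in decidable subsets and differences

∈-subset⁺ : ∀ {n} {P : Pred (Fin n) 0ℓ} (P? : Decidable₁ P) {v} → P v → v ∈ subset P?
∈-subset⁺ P? {v} Pv = lookup⇒[]= v _ (trans (lookup∘tabulate _ v) (dec-true (P? v) Pv))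

∈-subset⁻ : ∀ {n} {P : Pred (Fin n) 0ℓ} (P? : Decidable₁ P) {v} → v ∈ subset P? → P v
∈-subset⁻ P? {v} v∈ with P? v | trans (sym (lookup∘tabulate (does ∘ P?) v)) ([]=⇒lookup v∈)
... | yes Pv | _ = Pv
... | no  _  | ()

x∈p─q⇒x∉q : ∀ {n} (p q : Subset n) {x} → x ∈ p ─ q → x ∉ q
x∈p─q⇒x∉q (_ ∷ p) (inside  ∷ q) (there x∈) (there x∈q) = x∈p─q⇒x∉q p q x∈ x∈q
x∈p─q⇒x∉q (_ ∷ p) (outside ∷ q) (there x∈) (there x∈q) = x∈p─q⇒x∉q p q x∈ x∈q

full⇒≡⊤ : ∀ {n} {S : Subset n} → (∀ v → v ∈ S) → S ≡ ⊤
full⇒≡⊤ all = ⊆-antisym (λ _ → ∈⊤) (λ {v} _ → all v)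

-- Closed sets and the failed zero forcing number

module _ {n} (D : Digraph n) where
  open Digraph D

  -- Stability under one forcing step, phrased through arcs so that no set difference has to be
  -- handled. It does not ask for `w ∉ S`, since otherwise the conclusion is immediate; `forced-∈`
  -- and `forced-∈⇒closed` give the equivalence with `Forced`.
  Closed : Subset n → Set
  Closed S = ∀ {v w} → v ∈ S → Arc v w → (∀ u → Arc v u → u ≢ w → u ∈ S) → w ∈ S

  forced-∈ : ∀ {S} → Closed S → ∀ {w} → Forced D S w → w ∈ S
  forced-∈ {S} closed {w} (v , v∈S , eq) = closed v∈S (∈-subset⁻ (arc? v) (p─q⊆p _ _ w∈)) others
    where
    w∈ : w ∈ N⁺ D v ─ S
    w∈ = subst (w ∈_) (sym eq) (x∈⁅x⁆ w)
    others : ∀ u → Arc v u → u ≢ w → u ∈ S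
    others u vu u≢w with u ∈? S
    ... | yes u∈S = u∈S
    ... | no  u∉S = contradiction
      (x∈⁅y⁆⇒x≡y w (subst (u ∈_) eq (x∈p∧x∉q⇒x∈p─q (∈-subset⁺ (arc? v) vu) u∉S))) u≢w

  forced-∈⇒closed : ∀ {S} → (∀ {w} → Forced D S w → w ∈ S) → Closed S
  forced-∈⇒closed {S} f {v} {w} v∈S vw others with w ∈? S
  ... | yes w∈S = w∈S
  ... | no  w∉S = f (v , v∈S , ⊆-antisym ⇒ ⇐)
    where
    ⇒ : N⁺ D v ─ S ⊆ ⁅ w ⁆
    ⇒ {u} u∈ = decidable-stable (u ∈? ⁅ w ⁆) λ u∉ → x∈p─q⇒x∉q _ _ u∈
      (others u (∈-subset⁻ (arc? v) (p─q⊆p _ _ u∈)) (x∉⁅y⁆⇒x≢y u∉))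
    ⇐ : ⁅ w ⁆ ⊆ N⁺ D v ─ S
    ⇐ {u} u∈ with refl ← x∈⁅y⁆⇒x≡y w u∈ = x∈p∧x∉q⇒x∈p─q (∈-subset⁺ (arc? v) vw) w∉S

  B^-⊆-closed : ∀ {S} → Closed S → ∀ t → B^ D t S ⊆ S
  B^-⊆-closed closed zero    = id
  B^-⊆-closed {S} closed (suc t) x∈ with x∈p∪q⁻ (B^ D t S) _ x∈
  ... | inj₁ x∈B = B^-⊆-closed closed t x∈B
  ... | inj₂ x∈F = forced-∈ closed
    (subst (λ B → Forced D B _) B≡S (∈-subset⁻ (forced? D (B^ D t S)) x∈F))
    where
    S⊆B^ : ∀ t → S ⊆ B^ D t S
    S⊆B^ zero    = id
    S⊆B^ (suc t) = p⊆p∪q _ ∘ S⊆B^ t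
    B≡S : B^ D t S ≡ S
    B≡S = ⊆-antisym (B^-⊆-closed closed t) (S⊆B^ t)

  ∣S∣≤∣B^∣ : ∀ t S → ∣ S ∣ ≤ ∣ B^ D t S ∣
  ∣S∣≤∣B^∣ zero    S = ℕ.≤-refl
  ∣S∣≤∣B^∣ (suc t) S = ℕ.≤-trans (∣S∣≤∣B^∣ t S) (∣p∣≤∣p∪q∣ (B^ D t S) _)

  -- A stage that is not closed gains a vertex in the next step. Taking j = n + 1 then rules out the
  -- second alternative, so some stage is closed.
  closed-or-large : ∀ S j → (∃[ t ] Closed (B^ D t S)) ⊎ j ≤ ∣ B^ D j S ∣
  closed-or-large S zero = inj₂ z≤n
  closed-or-large S (suc j) with closed-or-large S j
  ... | inj₁ c = inj₁ c
  ... | inj₂ j≤ with any? (λ w → forced? D (B^ D j S) w ×-dec ¬? (w ∈? B^ D j S))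
  ...   | yes (w , fw , w∉) = inj₂ (ℕ.≤-<-trans j≤ (p⊂q⇒∣p∣<∣q∣
            (p⊆p∪q _ , w , x∈p∪q⁺ (inj₂ (∈-subset⁺ (forced? D (B^ D j S)) fw)) , w∉)))
  ...   | no ¬new = inj₁ (j , forced-∈⇒closed λ {w} fw →
            decidable-stable (w ∈? B^ D j S) (λ w∉ → ¬new (w , fw , w∉)))

  closure : ∀ S → ∃[ t ] Closed (B^ D t S)
  closure S = [ id , (λ n< → contradiction (∣p∣≤n (B^ D (suc n) S)) (ℕ.<⇒≱ n<)) ]′
    (closed-or-large S (suc n))

  -- A closed proper set never grows, so it fails. Conversely, the closure of a failed set is
  -- closed, proper and at least as large, so bounding closed sets is enough.
  maxClosed⇒failedNumber : ∀ {k} S → Closed S → S ≢ ⊤ → ∣ S ∣ ≡ k →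
    (∀ C → Closed C → C ≢ ⊤ → ∣ C ∣ ≤ k) → FailedZeroForcingNumber D k
  maxClosed⇒failedNumber S closed S≢⊤ ∣S∣≡k bound = (S , fails , ∣S∣≡k) , upper
    where
    fails : IsFZFS D S
    fails (t , B≡⊤) = S≢⊤ (full⇒≡⊤ λ v → B^-⊆-closed closed t (subst (v ∈_) (sym B≡⊤) ∈⊤))
    upper : ∀ T → IsFZFS D T → ∣ T ∣ ≤ _
    upper T fzfs with t , c ← closure T =
      ℕ.≤-trans (∣S∣≤∣B^∣ t T) (bound _ c (λ B≡⊤ → fzfs (t , B≡⊤)))

-- Digraphs on a cycle and how forcing spreads in them

next? : ∀ {n} → Decidable (Next {n})
next? {n} u v = (toℕ v ℕ.≟ suc (toℕ u)) ⊎-dec ((suc (toℕ u) ℕ.≟ n) ×-dec (toℕ v ℕ.≟ 0))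

next-functional : ∀ {n} {u v w : Fin n} → Next u v → Next u w → v ≡ w
next-functional (inj₁ v≡) (inj₁ w≡) = toℕ-injective (trans v≡ (sym w≡))
next-functional (inj₂ (_ , v≡)) (inj₂ (_ , w≡)) = toℕ-injective (trans v≡ (sym w≡))
next-functional {v = v} (inj₁ v≡) (inj₂ (u≡ , _)) = contradiction (trans v≡ u≡) (ℕ.<⇒≢ (toℕ<n v))
next-functional {w = w} (inj₂ (u≡ , _)) (inj₁ w≡) = contradiction (trans w≡ u≡) (ℕ.<⇒≢ (toℕ<n w))

next-irrefl : ∀ {m} (v : Fin (2 + m)) → ¬ Next v v
next-irrefl v (inj₁ v≡1+v) = ℕ.1+n≢n (sym v≡1+v)
next-irrefl v (inj₂ (1+v≡n , v≡0)) with () ← trans (cong suc (sym v≡0)) 1+v≡n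

≢⇔next₂ : ∀ (u v : Fin 2) → (Next u v ⊎ Next v u) ⇔ u ≢ v
≢⇔next₂ zero       zero       = mk⇔
  [ ⊥-elim ∘ next-irrefl _ , ⊥-elim ∘ next-irrefl _ ]′ (λ 0≢0 → contradiction refl 0≢0)
≢⇔next₂ zero       (suc zero) = mk⇔ (λ _ ()) (λ _ → inj₁ (inj₁ refl))
≢⇔next₂ (suc zero) zero       = mk⇔ (λ _ ()) (λ _ → inj₂ (inj₁ refl))
≢⇔next₂ (suc zero) (suc zero) = mk⇔
  [ ⊥-elim ∘ next-irrefl _ , ⊥-elim ∘ next-irrefl _ ]′ (λ 1≢1 → contradiction refl 1≢1)

-- `P` selects the tails of forward arcs and `R` those of backward arcs. Only the forward arc out of
-- 0 may be absent, and `covers` then supplies 1 → 0, so every edge of the cycle survives in the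
-- underlying graph.
module DecoratedCycle (m : ℕ) {P R : Pred ℕ 0ℓ} (P? : Decidable₁ P) (R? : Decidable₁ R)
  (P-suc : ∀ i → P (suc i)) (covers : P 0 ⊎ R 1) where

  V : Set
  V = Fin (2 + m)

  D : Digraph (2 + m)
  D = record
    { Arc  = λ u v → (Next u v × P (toℕ u)) ⊎ (toℕ u ≡ suc (toℕ v) × R (toℕ u))
    ; arc? = λ u v → (next? u v ×-dec P? (toℕ u)) ⊎-dec
                     ((toℕ u ℕ.≟ suc (toℕ v)) ×-dec R? (toℕ u))
    ; loopless = λ { v (inj₁ (next , _)) → next-irrefl v next
                   ; v (inj₂ (v≡1+v , _)) → ℕ.1+n≢n (sym v≡1+v) }
    }
  open Digraph D

  adjacent⇔next : ∀ u v → (Arc u v ⊎ Arc v u) ⇔ (Next u v ⊎ Next v u)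
  adjacent⇔next u v = mk⇔ [ arc⇒ , swap ∘ arc⇒ ]′ [ next⇒ , swap ∘ next⇒ ]′
    where
    arc⇒ : ∀ {u v} → Arc u v → Next u v ⊎ Next v u
    arc⇒ (inj₁ (next , _)) = inj₁ next
    arc⇒ (inj₂ (u≡ , _))   = inj₂ (inj₁ u≡)
    next⇒ : ∀ {u v} → Next u v → Arc u v ⊎ Arc v u
    next⇒ {suc u} next = inj₁ (inj₁ (next , P-suc (toℕ u)))
    next⇒ {zero} {v} (inj₁ v≡1) =
      [ (λ p → inj₁ (inj₁ (inj₁ v≡1 , p)))
      , (λ r → inj₂ (inj₂ (v≡1 , subst R (sym v≡1) r))) ]′ covers

  -- The state that travels forwards: the successor of v is the only out-neighbour that can still be
  -- outside S. Once v forces it, v is the backward neighbour of that successor, so readiness passes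
  -- on.
  Ready : Subset (2 + m) → V → Set
  Ready S v = P (toℕ v) × v ∈ S × (∀ u → toℕ v ≡ suc (toℕ u) → R (toℕ v) → u ∈ S)

  module _ {S} (closed : Closed D S) where

    force-next : ∀ {v w} → Ready S v → Next v w → w ∈ S
    force-next {v} {w} (p , v∈S , back) next = closed v∈S (inj₁ (next , p)) others
      where
      others : ∀ u → Arc v u → u ≢ w → u ∈ S
      others u (inj₁ (next′ , _)) u≢w = contradiction (next-functional next′ next) u≢w
      others u (inj₂ (v≡ , r)) _ = back u v≡ r

    force-previous : ∀ {v w} → v ∈ S → toℕ v ≡ suc (toℕ w) → R (toℕ v) →
      (∀ u → Next v u → u ∈ S) → w ∈ S
    force-previous {v} {w} v∈S v≡ r forward = closed v∈S (inj₂ (v≡ , r)) others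
      where
      others : ∀ u → Arc v u → u ≢ w → u ∈ S
      others u (inj₁ (next , _)) _ = forward u next
      others u (inj₂ (v≡′ , _)) u≢w =
        contradiction (toℕ-injective (ℕ.suc-injective (trans (sym v≡′) v≡))) u≢w

    ready-step : ∀ j → Ready S (inject₁ j) → Ready S (suc j)
    ready-step j ready@(_ , j∈S , _) =
      P-suc (toℕ j) , force-next ready (inj₁ (cong suc (sym (toℕ-inject₁ j)))) ,
      λ u j≡ _ → subst (_∈ S) (toℕ-injective (trans (toℕ-inject₁ j) (ℕ.suc-injective j≡))) j∈S

    ready-above : ∀ {v w} → Ready S v → toℕ v ≤ toℕ w → Ready S w
    ready-above ready = <-weakInduction-startingFrom (Ready S) ready ready-step

    ready⇒0∈ : ∀ {v} → Ready S v → zero ∈ S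
    ready⇒0∈ {v} ready = force-next (ready-above ready (≤fromℕ v))
      (inj₂ (cong suc (toℕ-fromℕ (suc m)) , refl))

    -- The forward sweep reaches 0. No backward arc leaves 0, so with its forward arc present it is
    -- ready at once, and a second sweep from 0 covers all vertices.
    ready⇒⊤-fullCycle : P 0 → ∀ {v} → Ready S v → S ≡ ⊤
    ready⇒⊤-fullCycle p ready = full⇒≡⊤ λ w → proj₁ (proj₂ (ready-above {w = w} ready₀ z≤n))
      where
      ready₀ : Ready S zero
      ready₀ = p , ready⇒0∈ ready , λ _ ()

    -- The only possible backward out-neighbour of v is u, so v is ready and the sweep fills
    -- everything from v up to the last vertex, and then 0. The vertices below v are filled by
    -- descending along the backward arcs.
    consecutive⇒⊤ : ∀ {u v} → u ∈ S → v ∈ S → toℕ v ≡ suc (toℕ u) →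
      (∀ {i} → i ≤ toℕ v → R i) → S ≡ ⊤
    consecutive⇒⊤ {u} {v} u∈S v∈S v≡ back = full⇒≡⊤ (proj₁ ∘ >-weakInduction Q Q-last Q-step)
      where
      ready : Ready S v
      ready = subst P (sym v≡) (P-suc _) , v∈S ,
        λ t v≡′ _ → subst (_∈ S) (toℕ-injective (ℕ.suc-injective (trans (sym v≡) v≡′))) u∈S
      above : ∀ {w} → toℕ v ≤ toℕ w → w ∈ S
      above = proj₁ ∘ proj₂ ∘ ready-above ready
      -- A backward force out of w + 1 needs the cyclic successor of w + 1 in S, so the descending
      -- induction carries successors along.
      Q : V → Set
      Q w = w ∈ S × (∀ z → Next w z → z ∈ S)
      Q-last : Q (fromℕ (suc m))
      Q-last = above (≤fromℕ v) , λ z next → subst (_∈ S)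
        (next-functional (inj₂ (cong suc (toℕ-fromℕ (suc m)) , refl)) next) (ready⇒0∈ ready)
      Q-step : ∀ j → Q (suc j) → Q (inject₁ j)
      Q-step j (j+1∈S , forward) = j∈S (toℕ v ≤? toℕ (inject₁ j)) , λ z next → subst (_∈ S)
          (next-functional {u = inject₁ j} (inj₁ (cong suc (sym (toℕ-inject₁ j)))) next) j+1∈S
        where
        j∈S : Dec (toℕ v ≤ toℕ (inject₁ j)) → inject₁ j ∈ S
        j∈S (yes v≤j) = above v≤j
        j∈S (no  v≰j) = force-previous j+1∈S (cong suc (sym (toℕ-inject₁ j)))
          (back (subst (_< toℕ v) (toℕ-inject₁ j) (ℕ.≰⇒> v≰j))) forward

isWeakCycle : ∀ m {P R : Pred ℕ 0ℓ} (P? : Decidable₁ P) (R? : Decidable₁ R)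
  (P-suc : ∀ i → P (suc i)) (covers : P 0 ⊎ R 1) →
  IsWeakCycle (DecoratedCycle.D m P? R? P-suc covers)
isWeakCycle zero P? R? P-suc covers = inj₂ (inj₁ (↔-id _ , λ u v →
  ≢⇔next₂ u v ⇔-∘ DecoratedCycle.adjacent⇔next 0 P? R? P-suc covers u v))
isWeakCycle (suc m) P? R? P-suc covers = inj₂ (inj₂ (_ , s≤s (s≤s (s≤s z≤n)) , ↔-id _ ,
  DecoratedCycle.adjacent⇔next (suc m) P? R? P-suc covers))

-- The odd numbers below 2k, and counting by pairs

Odd<2* : ℕ → Pred ℕ 0ℓ
Odd<2* k i = i < k * 2 × parity i ≡ 1ℙ

odd<2*? : ∀ k → Decidable₁ (Odd<2* k)
odd<2*? k i = (i <? k * 2) ×-dec (parity i ≟ᵖ 1ℙ)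

¬odd-consecutive : ∀ i → parity i ≡ 1ℙ → parity (suc i) ≢ 1ℙ
¬odd-consecutive (suc zero)    _ ()
¬odd-consecutive (suc (suc i)) = ¬odd-consecutive i

parity-2* : ∀ k → parity (k * 2) ≢ 1ℙ
parity-2* zero ()
parity-2* (suc k) = parity-2* k

odds : ∀ k {n} → Subset n
odds k = subset (odd<2*? k ∘ toℕ)

∈-odds⁺ : ∀ {k n} {v : Fin n} → Odd<2* k (toℕ v) → v ∈ odds k
∈-odds⁺ {k} = ∈-subset⁺ (odd<2*? k ∘ toℕ)

∈-odds⁻ : ∀ {k n} {v : Fin n} → v ∈ odds k → Odd<2* k (toℕ v)
∈-odds⁻ {k} = ∈-subset⁻ (odd<2*? k ∘ toℕ)

-- Both `k * 2` and `parity` unfold in steps of two, so dropping the first two vertices turns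
-- `odds (suc k)` into `odds k` by computation.
∣odds∣ : ∀ k n → k * 2 ≤ n → ∣ odds k {n} ∣ ≡ k
∣odds∣ zero    zero          _               = refl
∣odds∣ zero    (suc n)       _               = ∣odds∣ zero n z≤n
∣odds∣ (suc k) (suc (suc n)) (s≤s (s≤s 2k≤n)) = cong suc (∣odds∣ k n 2k≤n)

-- The pairs 2i, 2i + 1 with i < w are disjoint, and S misses a vertex of each.
∣pair-free∣ : ∀ w {n} (S : Subset n) → w * 2 ≤ n →
  (∀ {u v} → toℕ v ≡ suc (toℕ u) → Odd<2* w (toℕ v) → u ∈ S → v ∉ S) → ∣ S ∣ + w ≤ n
∣pair-free∣ zero S _ _ = subst (_≤ _) (sym (ℕ.+-identityʳ ∣ S ∣)) (∣p∣≤n S)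
∣pair-free∣ (suc w) {suc (suc n)} (a ∷ b ∷ S) (s≤s (s≤s 2w≤n)) free = go a b free
  where
  rest : ∣ S ∣ + w ≤ n
  rest = ∣pair-free∣ w S 2w≤n λ v≡ (v< , odd) u∈ v∈ →
    free (cong (2 +_) v≡) (s<s (s<s v<) , odd) (there (there u∈)) (there (there v∈))
  one : ∣ S ∣ + suc w ≤ suc n
  one = subst (_≤ suc n) (sym (ℕ.+-suc ∣ S ∣ w)) (s≤s rest)
  go : ∀ a b → (∀ {u v} → toℕ v ≡ suc (toℕ u) → Odd<2* (suc w) (toℕ v) →
    u ∈ a ∷ b ∷ S → v ∉ a ∷ b ∷ S) → ∣ a ∷ b ∷ S ∣ + suc w ≤ 2 + n
  go inside  inside  free = contradiction (there here) (free refl (s<s z<s , refl) here)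
  go inside  outside _ = s≤s one
  go outside inside  _ = s≤s one
  go outside outside _ = ℕ.m≤n⇒m≤1+n one

-- The case 2k < n

fullCycle : ∀ m k → k * 2 < 2 + m →
  Σ[ D ∈ Digraph (2 + m) ] (IsWeakCycle D × FailedZeroForcingNumber D k)
fullCycle m k 2k<n = D , isWeakCycle m P? R? _ (inj₁ tt) ,
  maxClosed⇒failedNumber D (odds k) closed odds≢⊤ (∣odds∣ k _ (ℕ.<⇒≤ 2k<n)) bound
  where
  P? : Decidable₁ {A = ℕ} (λ _ → Unit)
  P? _ = yes tt
  R? : Decidable₁ (Odd<2* k)
  R? = odd<2*? k
  open DecoratedCycle m P? R? _ (inj₁ tt)

  odds≢⊤ : odds k ≢ ⊤
  odds≢⊤ eq with () ← proj₂ (∈-odds⁻ {k} {2 + m} {zero} (subst (zero ∈_) (sym eq) ∈⊤))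

  -- A member v is odd, so its out-neighbours v - 1 and v + 1 are even and both lie outside the set;
  -- hence v forces nothing. As v + 1 ≤ 2k < n, the successor does not wrap around.
  closed : Closed D (odds k)
  closed {zero} v∈ _ _ with () ← proj₂ (∈-odds⁻ {k} v∈)
  closed {suc j} {w} v∈ _ others = ⊥-elim (absurd (before ≟ w))
    where
    v-odd : Odd<2* k (suc (toℕ j))
    v-odd = ∈-odds⁻ {k} v∈
    1+v<n : 2 + toℕ j < 2 + m
    1+v<n = ℕ.≤-<-trans (proj₁ v-odd) 2k<n
    before after : V
    before = inject₁ j
    after = fromℕ< 1+v<n
    after≡ : toℕ after ≡ 2 + toℕ j
    after≡ = toℕ-fromℕ< 1+v<n
    before∉ : before ∉ odds k
    before∉ before∈ = ¬odd-consecutive (toℕ j)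
      (subst (λ i → parity i ≡ 1ℙ) (toℕ-inject₁ j) (proj₂ (∈-odds⁻ {k} before∈))) (proj₂ v-odd)
    after∉ : after ∉ odds k
    after∉ after∈ = ¬odd-consecutive (suc (toℕ j)) (proj₂ v-odd)
      (subst (λ i → parity i ≡ 1ℙ) after≡ (proj₂ (∈-odds⁻ {k} after∈)))
    absurd : Dec (before ≡ w) → ⊥
    absurd (no before≢w) = before∉
      (others before (inj₂ (cong suc (sym (toℕ-inject₁ j)) , v-odd)) before≢w)
    absurd (yes before≡w) = after∉ (others after (inj₁ (inj₁ after≡ , tt)) λ after≡w →
      ℕ.m≢1+n+m (toℕ j) {1} (trans (sym (toℕ-inject₁ j))
        (trans (cong toℕ (trans before≡w (sym after≡w))) after≡)))

  bound : ∀ C → Closed D C → C ≢ ⊤ → ∣ C ∣ ≤ k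
  bound C closed C≢⊤ = subst (∣ C ∣ ≤_) (∣odds∣ k _ (ℕ.<⇒≤ 2k<n)) (p⊆q⇒∣p∣≤∣q∣ C⊆odds)
    where
    C⊆odds : C ⊆ odds k
    -- No backward arc leaves a vertex outside `odds k`, so such a vertex is ready as soon as it
    -- belongs to C.
    C⊆odds {v} v∈C = decidable-stable (v ∈? odds k) λ v∉ → C≢⊤
      (ready⇒⊤-fullCycle closed tt
        (tt , v∈C , λ _ _ v-odd → contradiction (∈-odds⁺ {k} v-odd) v∉))

-- The case 2k ≥ n

cutCycle : ∀ m w → suc w * 2 ≤ 2 + m →
  Σ[ D ∈ Digraph (2 + m) ] (IsWeakCycle D × FailedZeroForcingNumber D (2 + m ∸ suc w))
-- Since w ≥ 1, the backward arc 1 → 0 exists and keeps the edge between 0 and 1 although 0 → 1 is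
-- omitted.
cutCycle m w′ 2w≤n = D , isWeakCycle m P? R? (λ _ → z<s) (inj₂ (s<s z<s)) ,
  maxClosed⇒failedNumber D (∁ (odds w)) closed ∁odds≢⊤
    (trans (∣∁p∣≡n∸∣p∣ (odds w {2 + m})) (cong (2 + m ∸_) (∣odds∣ w _ 2w≤n))) bound
  where
  w : ℕ
  w = suc w′
  P? : Decidable₁ (0 <_)
  P? = 0 <?_
  R? : Decidable₁ (_< w * 2)
  R? = _<? w * 2
  open DecoratedCycle m P? R? (λ _ → z<s) (inj₂ (s<s z<s))
  open Digraph D

  ∁odds≢⊤ : ∁ (odds w) ≢ ⊤
  ∁odds≢⊤ eq = x∈p⇒x∉∁p {x = suc zero} (∈-odds⁺ {w} (s<s z<s , refl))
    (subst (suc zero ∈_) (sym eq) ∈⊤)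

  -- A vertex with an arc to some x in `odds w` also has an arc to x - 2 or x + 2 in `odds w`, so it
  -- cannot force x.
  closed : Closed D (∁ (odds w))
  closed {v} {x} _ arc others = x∉p⇒x∈∁p (absurd arc others ∘ ∈-odds⁻ {w})
    where
    absurd : ∀ {v} → Arc v x → (∀ u → Arc v u → u ≢ x → u ∈ ∁ (odds w)) → ¬ Odd<2* w (toℕ x)
    -- The tail is never 0 here: 0 would force 1, which is why 0 → 1 is left out.
    absurd {suc j} (inj₁ (inj₁ x≡ , _)) others x-odd =
      x∈∁p⇒x∉p (others before (inj₂ (cong suc (sym before≡) , 1+j<2w)) before≢x)
        (∈-odds⁺ {w} (subst (Odd<2* w) (sym before≡) (ℕ.<⇒≤ 1+j<2w , proj₂ 2+j-odd)))
      where
      before : V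
      before = inject₁ j
      before≡ : toℕ before ≡ toℕ j
      before≡ = toℕ-inject₁ j
      2+j-odd : Odd<2* w (2 + toℕ j)
      2+j-odd = subst (Odd<2* w) x≡ x-odd
      1+j<2w : suc (toℕ j) < w * 2
      1+j<2w = ℕ.<⇒≤ (proj₁ 2+j-odd)
      before≢x : before ≢ x
      before≢x refl = ℕ.m≢1+n+m (toℕ j) {1} (trans (sym before≡) x≡)
    absurd (inj₁ (inj₂ (_ , x≡0) , _)) _ (_ , odd) with () ← trans (cong parity (sym x≡0)) odd
    absurd {v} (inj₂ (v≡ , v<2w)) others (_ , odd) =
      x∈∁p⇒x∉p (others after (inj₁ (inj₁ after≡ , subst (0 <_) (sym v≡) z<s)) after≢x)
        (∈-odds⁺ {w} (subst (_< w * 2) (sym after≡) 1+v<2w , trans (cong parity after≡2+x) odd))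
      where
      1+v<2w : suc (toℕ v) < w * 2
      -- The number v + 1 = x + 2 is odd and 2w is even, so they differ.
      1+v<2w = ℕ.≤∧≢⇒< v<2w λ 1+v≡2w →
        parity-2* w (trans (cong parity (trans (sym 1+v≡2w) (cong suc v≡))) odd)
      1+v<n : suc (toℕ v) < 2 + m
      1+v<n = ℕ.<-≤-trans 1+v<2w 2w≤n
      after : V
      after = fromℕ< 1+v<n
      after≡ : toℕ after ≡ suc (toℕ v)
      after≡ = toℕ-fromℕ< 1+v<n
      after≡2+x : toℕ after ≡ 2 + toℕ x
      after≡2+x = trans after≡ (cong suc v≡)
      after≢x : after ≢ x
      after≢x after≡x = ℕ.m≢1+n+m (toℕ x) {1} (trans (cong toℕ (sym after≡x)) after≡2+x)

  bound : ∀ C → Closed D C → C ≢ ⊤ → ∣ C ∣ ≤ 2 + m ∸ w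
  bound C closed C≢⊤ = ℕ.m+n≤o⇒m≤o∸n ∣ C ∣ (∣pair-free∣ w C 2w≤n
    λ v≡ (v<2w , _) u∈ v∈ → C≢⊤ (consecutive⇒⊤ closed u∈ v∈ v≡ (λ i≤v → ℕ.≤-<-trans i≤v v<2w)))

-- The one-vertex case and the choice of construction

singleVertex : Σ[ D ∈ Digraph 1 ] (IsWeakCycle D × FailedZeroForcingNumber D 0)
singleVertex = D , inj₁ (↔-id _ , edges) ,
  maxClosed⇒failedNumber D (outside ∷ []) (λ { {zero} () }) (λ ()) refl bound
  where
  D : Digraph 1
  D = record { Arc = λ _ _ → ⊥ ; arc? = λ _ _ → no λ () ; loopless = λ _ () }
  edges : ∀ (u v : Fin 1) → (⊥ ⊎ ⊥) ⇔ u ≢ v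
  edges zero zero = mk⇔ [ ⊥-elim , ⊥-elim ]′ (λ 0≢0 → contradiction refl 0≢0)
  bound : ∀ C → Closed D C → C ≢ ⊤ → ∣ C ∣ ≤ 0
  bound (inside  ∷ []) _ C≢⊤ = contradiction refl C≢⊤
  bound (outside ∷ []) _ _   = z≤n

theorem4p11 : (n k : ℕ) → k < n →
    Σ[ D ∈ Digraph n ] (IsWeakCycle D × FailedZeroForcingNumber D k)
theorem4p11 (suc zero)    zero    _             = singleVertex
theorem4p11 (suc zero)    (suc k) (s≤s ())
theorem4p11 (suc (suc m)) k       k<n with k * 2 <? 2 + m
... | yes 2k<n = fullCycle m k 2k<n
... | no  2k≮n = subst
    (λ k → Σ[ D ∈ Digraph (2 + m) ] (IsWeakCycle D × FailedZeroForcingNumber D k))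
    -- The number of pairs is w = n - k, which is positive; `cutCycle` takes its predecessor n - 1 -
    -- k. The w pairs fit into n vertices exactly because 2k ≥ n.
    n∸w≡k (cutCycle m (suc m ∸ k) 2w≤n)
  where
  w≡ : suc (suc m ∸ k) ≡ 2 + m ∸ k
  w≡ = sym (ℕ.+-∸-assoc 1 (s≤s⁻¹ k<n))
  n∸w≡k : 2 + m ∸ suc (suc m ∸ k) ≡ k
  n∸w≡k = trans (cong (2 + m ∸_) w≡) (ℕ.m∸[m∸n]≡n (ℕ.<⇒≤ k<n))
  2w≤n : suc (suc m ∸ k) * 2 ≤ 2 + m
  2w≤n = begin
    suc (suc m ∸ k) * 2     ≡⟨ cong (_* 2) w≡ ⟩
    (2 + m ∸ k) * 2         ≡⟨ ℕ.*-distribʳ-∸ 2 (2 + m) k ⟩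
    (2 + m) * 2 ∸ k * 2     ≤⟨ ℕ.∸-monoʳ-≤ ((2 + m) * 2) (ℕ.≮⇒≥ 2k≮n) ⟩
    (2 + m) * 2 ∸ (2 + m)   ≡⟨ cong (_∸ (2 + m)) (ℕ.*-comm (2 + m) 2) ⟩
    (2 + m) + (2 + m + 0) ∸ (2 + m) ≡⟨ ℕ.m+n∸m≡n (2 + m) _ ⟩
    2 + m + 0               ≡⟨ ℕ.+-identityʳ _ ⟩
    2 + m                   ∎
    where open ℕ.≤-Reasoning
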